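{- Let $M=(S,S_0,\Delta)$ be the counter system of disjunctive process templates $A,B$. Then $(M,\lessapprox_0)$ is a well-structured transition system with effective $\mathit{opred}$-basis, i.e., $\lessapprox_0$ is a well-quasi-order compatible with $\Delta$, and there exists an algorithm that takes as input any finite set $R\subseteq S$ and returns a finite basis (with respect to $\lessapprox_0$) of $\mathit{opred}({\uparrow_0}R)$, where ${\uparrow_0}R$ is the upward closure of $R$ with respect to $\lessapprox_0$.
   Context: Let $Q_A,Q_B$ be disjoint finite sets, $Q=Q_A\cup Q_B$. A (disjunctive) process template is $U=(Q_U,\mathit{init}_U,\mathcal G_U,\delta_U)$, $U\in\{A,B\}$, with $\mathit{init}_U\in Q_U$, guards $\mathcal G_U\subseteq\mathcal P(Q)$, total $\delta_U\subseteq Q_U\times\mathcal G_U\times Q_U$. Standing assumption: $\delta_B$ contains no transition $(q_i,\{q_i\},q_j)$. Write $Q_B=\{q_0,\dots,q_{|B|-1}\}$, $\vec u_i$ unit vectors. Counter system $M=(S,S_0,\Delta)$: $S=Q_A\times\mathbb N_0^{|B|}$, $S_0=\{(\mathit{init}_A,\vec c)\mid\vec c(q)=0\text{ for }q\ne\mathit{init}_B\}$, and $((q_A,\vec c),(q'_A,\vec c'))\in\Delta$ iff (1) $\vec c'=\vec c$ and some $(q_A,g,q'_A)\in\delta_A$ has some $q_i\in g\cap Q_B$ with $\vec c(i)\ge1$; or (2) $q'_A=q_A$ and some $(q_i,g,q_j)\in\delta_B$ has $\vec c(i)\ge1$, $\vec c'=\vec c-\vec u_i+\vec u_j$, and ($q_A\in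 g$, or some $q_l\in g\cap Q_B$, $l\ne i$, with $\vec c(l)\ge1$, or $q_i\in g$ and $\vec c(i)\ge2$); a type (2) step is based on the local transition $(q_i,g,q_j)$. Order: $(q_A,\vec c)\lessapprox_0(q'_A,\vec d)$ iff $q_A=q'_A$, $\vec c\le\vec d$ componentwise and $\vec c(i)=0\Leftrightarrow\vec d(i)=0$ for all $i$. Compatibility: $s\to s'$ and $s\lessapprox_0 r$ imply $\exists r'$ with $s'\lessapprox_0 r'$ and $r\to^* r'$. $\mathit{pred}(R)=\{s\mid\exists r\in R:(s,r)\in\Delta\}$; $\mathit{opred}(R)=\mathit{pred}(R)\cup\{(q_A,\vec c)\mid\exists(q'_A,\vec c')\in R,\exists t=(q_i,g,q_j)\in\delta_B$: $(q'_A,\vec c')$ reachable from $(q_A,\vec c)$ by one or more $\Delta$-steps each based on $t$, and ($\vec c(j)=0$ or $\vec c'(i)=0$)$\}$. A basis of an upward-closed set $X$ is a set whose upward closure is $X$. -}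

module Defs where

open import Data.Nat using (ℕ; zero; suc; _≤_; _<_; _∸_; _+_)
open import Data.Fin using (Fin)
open import Data.Fin.Subset using (Subset; _∈_)
open import Data.Vec using (Vec; lookup; replicate; _[_]%=_; _[_]≔_)
open import Data.Product using (Σ; ∃; ∃-syntax; _×_; _,_; proj₁; proj₂)
open import Data.Sum using (_⊎_)
open import Data.List using (List)
open import Data.List.Membership.Propositional renaming (_∈_ to _∈ₗ_)
open import Relation.Nullary using (¬_)
open import Relation.Binary.PropositionalEquality using (_≡_; _≢_)
open import Relation.Binary.Construct.Closure.ReflexiveTransitive using (Star)
open import Relation.Binary.Construct.Closure.Transitive using (TransClosure)
open import Function.Bundles using (_⇔_)

-- Local states: Q_A = Fin nA, Q_B = Fin nB (disjoint union Q = Q_A ⊎ Q_B).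
-- A guard g ⊆ Q is given by its two parts g ∩ Q_A and g ∩ Q_B.

Guard : ℕ → ℕ → Set
Guard nA nB = Subset nA × Subset nB

-- A disjunctive process template over local states Fin n (n = nA or nB).
-- The set of guards G_U is implicitly the set of guards occurring in δ.
record Template (nA nB n : ℕ) : Set where
  field
    init  : Fin n
    δ     : List (Fin n × Guard nA nB × Fin n)
    total : ∀ (q : Fin n) → ∃[ g ] ∃[ q' ] ((q , g , q') ∈ₗ δ)

open Template public

-- Standing assumption: δ_B contains no transition (q_i, {q_i}, q_j),
-- i.e. no transition from q_i whose guard is exactly the singleton {q_i}.
NoSelfGuard : ∀ {nA nB} → Template nA nB nB → Set
NoSelfGuard {nA} {nB} B =
  ∀ (qi : Fin nB) (g : Guard nA nB) (qj : Fin nB) → (qi , g , qj) ∈ₗ δ B →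
    ¬ ((∀ (a : Fin nA) → ¬ (a ∈ proj₁ g)) ×
       (∀ (b : Fin nB) → (b ∈ proj₂ g) ⇔ (b ≡ qi)))

module CounterSystem {nA nB : ℕ} (A : Template nA nB nA) (B : Template nA nB nB) where

  S : Set
  S = Fin nA × Vec ℕ nB

  S₀ : S → Set
  S₀ (qA , c) = qA ≡ init A × (∀ (q : Fin nB) → q ≢ init B → lookup c q ≡ 0)

  move : Vec ℕ nB → Fin nB → Fin nB → Vec ℕ nB
  move c i j = (c [ i ]%= (λ x → x ∸ 1)) [ j ]%= suc

  BasedOn : (Fin nB × Guard nA nB × Fin nB) → S → S → Set
  BasedOn (i , g , j) (qA , c) (qA' , c') =
    qA' ≡ qA × 1 ≤ lookup c i × c' ≡ move c i j ×
    (qA ∈ proj₁ g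
     ⊎ (∃[ l ] (l ∈ proj₂ g × l ≢ i × 1 ≤ lookup c l))
     ⊎ (i ∈ proj₂ g × 2 ≤ lookup c i))

  Δ : S → S → Set
  Δ (qA , c) (qA' , c') =
    (c' ≡ c × ∃[ g ] (((qA , g , qA') ∈ₗ δ A) ×
                      ∃[ i ] (i ∈ proj₂ g × 1 ≤ lookup c i)))
    ⊎ (∃[ t ] (t ∈ₗ δ B × BasedOn t (qA , c) (qA' , c')))

  _≲₀_ : S → S → Set
  (qA , c) ≲₀ (qA' , d) =
    qA ≡ qA' × (∀ (i : Fin nB) → lookup c i ≤ lookup d i)
             × (∀ (i : Fin nB) → (lookup c i ≡ 0) ⇔ (lookup d i ≡ 0))

  IsWQO : (S → S → Set) → Set
  IsWQO _≲_ = (∀ s → s ≲ s)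
            × (∀ s t u → s ≲ t → t ≲ u → s ≲ u)
            × (∀ (f : ℕ → S) → ∃[ i ] ∃[ j ] (i < j × f i ≲ f j))

  Compatible : (S → S → Set) → Set
  Compatible _≲_ = ∀ s s' r → Δ s s' → s ≲ r → ∃[ r' ] (s' ≲ r' × Star Δ r r')

  pred : (S → Set) → S → Set
  pred R s = ∃[ r ] (R r × Δ s r)

  opred : (S → Set) → S → Set
  opred R (qA , c) =
    pred R (qA , c)
    ⊎ (∃[ s' ] (R s' × ∃[ t ] (t ∈ₗ δ B ×
         TransClosure (BasedOn t) (qA , c) s' ×
         (lookup c (proj₂ (proj₂ t)) ≡ 0 ⊎ lookup (proj₂ s') (proj₁ t) ≡ 0))))

  ↑₀ : List S → S → Set
  ↑₀ R s = ∃[ r ] (r ∈ₗ R × r ≲₀ s)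

  IsBasis : List S → (S → Set) → Set
  IsBasis Bs X = ∀ (s : S) → ↑₀ Bs s ⇔ X s

  WSTSWithEffectiveOpredBasis : Set
  WSTSWithEffectiveOpredBasis =
    IsWQO _≲₀_ × Compatible _≲₀_ ×
    Σ (List S → List S) (λ alg → ∀ (R : List S) → IsBasis (alg R) (opred (↑₀ R)))

{-# OPTIONS --safe #-}
module Submission where

-- ≲₀ is a well-quasi-order by Dickson's lemma, proved constructively with almost-full
-- relations. It is compatible with Δ: a step from s is copied by any r ≳₀ s, except when it
-- empties q_i in s but not in r; then r moves all its q_i-processes to q_j one by one, which
-- is possible because such a step is enabled without the process that moves.
--
-- Let M bound the entries of R. The set opred(↑₀R) is upward closed (an extra process is
-- absorbed, if need be by one more step of the same chain), and a member with a counter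
-- above 2M+3 stays a member when one process is removed from that counter. Hence the
-- members all of whose counters are at most 2M+3 form a finite basis; it is computable
-- because membership in opred(↑₀R) is decidable, a chain based on q_i → q_j (i ≠ j) having
-- at most c(i) steps.

open import Defs

open import Level using (0ℓ)
open import Data.Empty using (⊥-elim)
open import Data.Fin using (Fin; zero; suc; _≟_; toℕ)
open import Data.Fin.Properties using (toℕ-injective; toℕ<n) renaming (any? to fin-any?; all? to fin-all?)
open import Data.Fin.Subset using (_∈_)
open import Data.Fin.Subset.Properties using (_∈?_)
open import Data.List using (List; []; _∷_; concatMap; filter; cartesianProductWith; cartesianProduct; upTo; allFin)
open import Data.List.Extrema.Nat using (max; xs≤max)
open import Data.List.Membership.Propositional using (lose; find) renaming (_∈_ to _∈ₗ_)
open import Data.List.Membership.Propositional.Properties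
  using (∈-concatMap⁺; ∈-filter⁺; ∈-filter⁻; ∈-cartesianProductWith⁺; ∈-cartesianProduct⁺; ∈-upTo⁺; ∈-allFin)
import Data.List.Relation.Unary.All as All
open import Data.List.Relation.Unary.Any using (Any; here; any?)
open import Data.Nat using (ℕ; zero; suc; _≤_; _<_; _∸_; _+_; _⊓_; z≤n; s≤s; _≤?_; _<?_)
  renaming (_≟_ to _≟ℕ_)
open import Data.Nat.Properties hiding (_≟_)
open import Algebra.Properties.CommutativeSemigroup +-commutativeSemigroup using (x∙yz≈y∙xz)
open import Data.Product using (∃-syntax; _×_; _,_; proj₁; proj₂)
open import Data.Sum using (_⊎_; inj₁; inj₂; [_,_]; assocʳ)
  renaming (map to ⊎-map; map₁ to ⊎-map₁; map₂ to ⊎-map₂)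
open import Data.Vec using (Vec; []; _∷_; lookup; head; tail; map; toList; _[_]%=_)
open import Data.Vec.Membership.Propositional.Properties using (∈-toList⁺; ∈-lookup)
open import Data.Vec.Properties
  using (lookup∘updateAt; lookup∘updateAt′; updateAt-updateAt; updateAt-id-local; lookup-map)
open import Data.Vec.Relation.Binary.Pointwise.Extensional using (ext; Pointwise-≡⇒≡)
open import Function using (_on_; _∘_)
open import Function.Bundles using (_⇔_; mk⇔; Equivalence)
import Function.Properties.Equivalence as ⇔
open import Relation.Binary using (Rel; _⇒_)
open import Relation.Binary.Construct.Closure.ReflexiveTransitive using (Star; ε; _◅_)
open import Relation.Binary.Construct.Closure.Transitive using (TransClosure; _∷_; _∷ʳ_) renaming ([_] to [_]⁺)
open import Relation.Binary.Construct.Intersection using (_∩_)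
open import Relation.Binary.PropositionalEquality
  using (_≡_; _≢_; refl; sym; trans; cong; cong₂; subst; subst₂; module ≡-Reasoning)
open import Relation.Nullary using (¬_; Dec; yes; no; ¬?; _×-dec_; _⊎-dec_)
open import Relation.Nullary.Decidable using (map′)

-- Almost-full relations (Vytiniotis, Coquand and Wahlstedt, ITP 2012)

Residual : {X : Set} → Rel X 0ℓ → X → Rel X 0ℓ
Residual R x y z = R y z ⊎ R x y

data AlmostFull {X : Set} : Rel X 0ℓ → Set₁ where
  now   : ∀ {R} → (∀ x y → R x y) → AlmostFull R
  later : ∀ {R} → (∀ x → AlmostFull (Residual R x)) → AlmostFull R

module _ {X : Set} where

  af-mono : ∀ {R T : Rel X 0ℓ} → R ⇒ T → AlmostFull R → AlmostFull T
  af-mono R⇒T (now r) = now λ x y → R⇒T (r x y)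
  af-mono R⇒T (later af) = later λ x → af-mono (⊎-map R⇒T R⇒T) (af x)

  af-∪-nullary : ∀ {S R : Rel X 0ℓ} {P Q : Set} →
                 AlmostFull S → S ⇒ (λ y z → R y z ⊎ P) →
                 AlmostFull (λ y z → R y z ⊎ Q) → AlmostFull (λ y z → R y z ⊎ (P × Q))
  af-∪-nullary (now s) S⇒R∪P afQ =
    af-mono (λ {y} {z} → [ inj₁ , (λ q → ⊎-map₂ (_, q) (S⇒R∪P (s y z))) ]) afQ
  af-∪-nullary {S} {R} {P} (later afS) S⇒R∪P afQ = later λ x →
    af-mono reassoc (af-∪-nullary (afS x) (residual-⇒ x) (af-mono (⊎-map₁ inj₁) afQ))
    where
    residual-⇒ : ∀ x → Residual S x ⇒ (λ y z → Residual R x y z ⊎ P)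
    residual-⇒ x = [ ⊎-map₁ inj₁ ∘ S⇒R∪P , ⊎-map₁ inj₂ ∘ S⇒R∪P ]
    reassoc : ∀ {A B C : Set} → (A ⊎ B) ⊎ C → (A ⊎ C) ⊎ (B ⊎ C)
    reassoc = [ ⊎-map inj₁ inj₁ , inj₁ ∘ inj₂ ]

  private
    either-pair : ∀ {A P Q : Set} → A ⊎ P → A ⊎ Q → A ⊎ (P × Q)
    either-pair (inj₁ a) _ = inj₁ a
    either-pair (inj₂ p) q = ⊎-map₂ (p ,_) q

  af-∪-unary : ∀ {S T R : Rel X 0ℓ} {U V : X → Set} →
               AlmostFull S → S ⇒ (λ y z → R y z ⊎ U y) →
               AlmostFull T → T ⇒ (λ y z → R y z ⊎ V y) →
               AlmostFull (λ y z → R y z ⊎ (U y × V y))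
  af-∪-unary (now s) S⇒R∪U afT T⇒R∪V =
    af-mono (λ {y} {z} t → either-pair (S⇒R∪U (s y z)) (T⇒R∪V t)) afT
  af-∪-unary (later afS) S⇒R∪U (now t) T⇒R∪V =
    af-mono (λ {y} {z} s → either-pair (S⇒R∪U s) (T⇒R∪V (t y z))) (later afS)
  af-∪-unary {S} {T} {R} {U} {V} (later afS) S⇒R∪U (later afT) T⇒R∪V = later λ x →
    af-mono assocʳ (af-∪-nullary
      (af-mono reassoc (af-∪-unary (afS x) (extend-residual x S⇒R∪U) (later afT) (extend x T⇒R∪V)))
      (λ r → r)
      (af-mono reassoc (af-∪-unary (later afS) (extend x S⇒R∪U) (afT x) (extend-residual x T⇒R∪V))))
    where
    Extended : X → Set → Rel X 0ℓ
    Extended x P y z = (R y z ⊎ R x y) ⊎ P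

    extend : ∀ {Q : Rel X 0ℓ} {W : X → Set} {P : Set} x → Q ⇒ (λ y z → R y z ⊎ W y) →
             Q ⇒ (λ y z → Extended x P y z ⊎ W y)
    extend x Q⇒R∪W = ⊎-map₁ (inj₁ ∘ inj₁) ∘ Q⇒R∪W

    extend-residual : ∀ {Q : Rel X 0ℓ} {W : X → Set} x → Q ⇒ (λ y z → R y z ⊎ W y) →
                      Residual Q x ⇒ (λ y z → Extended x (W x) y z ⊎ W y)
    extend-residual x Q⇒R∪W = [ extend x Q⇒R∪W , inj₁ ∘ [ inj₁ ∘ inj₂ , inj₂ ] ∘ Q⇒R∪W ]

    reassoc : ∀ {A B W P : Set} → ((A ⊎ B) ⊎ W) ⊎ P → ((A ⊎ P) ⊎ B) ⊎ W
    reassoc = [ [ inj₁ ∘ ⊎-map₁ inj₁ , inj₂ ] , inj₁ ∘ inj₁ ∘ inj₂ ]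

  af-∩ : ∀ {R T : Rel X 0ℓ} → AlmostFull R → AlmostFull T → AlmostFull (R ∩ T)
  af-∩ (now r) afT = af-mono (λ {y} {z} t → r y z , t) afT
  af-∩ (later afR) (now t) = af-mono (λ {y} {z} r → r , t y z) (later afR)
  af-∩ (later afR) (later afT) = later λ x →
    af-∪-unary (af-∩ (afR x) (later afT)) (λ { (inj₁ r , t) → inj₁ (r , t) ; (inj₂ r , _) → inj₂ r })
               (af-∩ (later afR) (afT x))  (λ { (r , inj₁ t) → inj₁ (r , t) ; (_ , inj₂ t) → inj₂ t })

  af-good : ∀ {R : Rel X 0ℓ} → AlmostFull R → (f : ℕ → X) →
            ∃[ i ] ∃[ j ] (i < j × R (f i) (f j))
  af-good (now r) f = 0 , 1 , s≤s z≤n , r (f 0) (f 1)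
  af-good (later af) f with af-good (af (f 0)) (f ∘ suc)
  ... | i , j , i<j , inj₁ r = suc i , suc j , s≤s i<j , r
  ... | i , j , _   , inj₂ r = 0 , suc i , s≤s z≤n , r

af-on : ∀ {X Y : Set} {R : Rel X 0ℓ} → AlmostFull R → (f : Y → X) → AlmostFull (R on f)
af-on (now r) f = now λ y z → r (f y) (f z)
af-on (later af) f = later λ y → af-on (af (f y)) f

af-≤ : AlmostFull _≤_
af-≤ = later ≤-or-above
  where
  ≤-or-above : ∀ m → AlmostFull (λ y z → y ≤ z ⊎ m ≤ y)
  ≤-or-above zero = now λ _ _ → inj₂ z≤n
  ≤-or-above (suc m) = later λ x → residual x (x ≤? m)
    where
    residual : ∀ x → Dec (x ≤ m) → AlmostFull (Residual (λ y z → y ≤ z ⊎ suc m ≤ y) x)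
    residual x (yes x≤m) = af-mono (⊎-map inj₁ (inj₁ ∘ ≤-trans x≤m)) (≤-or-above m)
    residual x (no x≰m) = now λ _ _ → inj₂ (inj₂ (≰⇒> x≰m))

af-≡ : ∀ {n} → AlmostFull {Fin n} _≡_
af-≡ {n} = af-mono (λ (a≤b , n-a≤n-b) → toℕ-injective (≤-antisym a≤b (reverse-≤ n-a≤n-b)))
                   (af-∩ (af-on af-≤ toℕ) (af-on af-≤ (λ a → n ∸ toℕ a)))
  where
  reverse-≤ : ∀ {a b : Fin n} → n ∸ toℕ a ≤ n ∸ toℕ b → toℕ b ≤ toℕ a
  reverse-≤ {a} {b} le =
    subst₂ _≤_ (m∸[m∸n]≡n (<⇒≤ (toℕ<n b))) (m∸[m∸n]≡n (<⇒≤ (toℕ<n a))) (∸-monoʳ-≤ n le)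

∸1< : ∀ {x} → 1 ≤ x → x ∸ 1 < x
∸1< {suc x} _ = ≤-refl

<∸1⇒< : ∀ {n x} → n < x ∸ 1 → suc n < x
<∸1⇒< {x = suc x} n<x-1 = s≤s n<x-1

above-threshold : ∀ M {x} → suc M + suc (suc M) < x → 3 + M < x
above-threshold M big = ≤-trans (s≤s (s≤s (m≤n+m (suc (suc M)) M))) big

gap⇒<∸2 : ∀ {m x} → 3 + m < x → suc m < x ∸ 1 ∸ 1
gap⇒<∸2 gap = ∸-monoˡ-≤ 1 (∸-monoˡ-≤ 1 gap)

gap⇒<∸1 : ∀ {m x} → 3 + m < x → suc m < x ∸ 1
gap⇒<∸1 gap = ≤-trans (n≤1+n _) (∸-monoˡ-≤ 1 gap)

gap⇒< : ∀ {m x} → 3 + m < x → suc m < x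
gap⇒< {m} gap = ≤-trans (m≤n+m (2 + m) 2) gap

gap⇒2≤ : ∀ {m x} → 3 + m < x → 2 ≤ x
gap⇒2≤ gap = ≤-trans (s≤s (s≤s z≤n)) gap

gap⇒3≤ : ∀ {m x} → 3 + m < x → 3 ≤ x
gap⇒3≤ gap = ≤-trans (s≤s (s≤s (s≤s z≤n))) gap

conserved-above : ∀ M {a b x y} → a + b ≡ x + y → a ≤ suc M → suc M + suc (suc M) < x → suc M < b
conserved-above M {a} {b} {x} {y} a+b≡x+y a≤ big = +-cancelˡ-≤ (suc M) _ _ (begin
  suc M + suc (suc M)  ≤⟨ <⇒≤ big ⟩
  x                    ≤⟨ m≤m+n x y ⟩
  x + y                ≡⟨ a+b≡x+y ⟨
  a + b                ≤⟨ +-monoˡ-≤ b a≤ ⟩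
  suc M + b            ∎)
  where open ≤-Reasoning

ZeroIff : Rel ℕ 0ℓ
ZeroIff a b = (a ≡ 0) ⇔ (b ≡ 0)

zeroIff-pos : ∀ {a b} → 1 ≤ a → 1 ≤ b → ZeroIff a b
zeroIff-pos (s≤s _) (s≤s _) = mk⇔ (λ ()) (λ ())

zeroIff-pos⇒ : ∀ {a b} → ZeroIff a b → 1 ≤ a → 1 ≤ b
zeroIff-pos⇒ {b = zero} a~b (s≤s _) with () ← Equivalence.from a~b refl
zeroIff-pos⇒ {b = suc _} _ _ = s≤s z≤n

zeroIff? : ∀ a b → Dec (ZeroIff a b)
zeroIff? zero zero = yes ⇔.refl
zeroIff? zero (suc b) = no λ a~b → 1+n≢0 (Equivalence.to a~b refl)
zeroIff? (suc a) zero = no λ a~b → 1+n≢0 (Equivalence.from a~b refl)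
zeroIff? (suc a) (suc b) = yes (zeroIff-pos (s≤s z≤n) (s≤s z≤n))

∸1-zeroIff⊎straddle : ∀ {a b} → a ≤ b → ZeroIff (a ∸ 1) (b ∸ 1) ⊎ (a ≤ 1 × 2 ≤ b)
∸1-zeroIff⊎straddle {a} {b} a≤b with 2 ≤? a | 2 ≤? b
... | yes 2≤a | _ = inj₁ (zeroIff-pos (∸-monoˡ-≤ 1 2≤a) (∸-monoˡ-≤ 1 (≤-trans 2≤a a≤b)))
... | no 2≰a | yes 2≤b = inj₂ (≤-pred (≰⇒> 2≰a) , 2≤b)
... | no _ | no 2≰b = inj₁ (mk⇔ (λ _ → m≤n⇒m∸n≡0 b≤1) (λ _ → m≤n⇒m∸n≡0 (≤-trans a≤b b≤1)))
  where
  b≤1 : b ≤ 1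
  b≤1 = ≤-pred (≰⇒> 2≰b)

af-≤∩zeroIff : AlmostFull (_≤_ ∩ ZeroIff)
af-≤∩zeroIff =
  af-mono (λ (a≤b , 1-a≤1-b) → a≤b , zeroIff a≤b 1-a≤1-b) (af-∩ af-≤ (af-on af-≤ (1 ∸_)))
  where
  zeroIff : ∀ {a b} → a ≤ b → 1 ∸ a ≤ 1 ∸ b → ZeroIff a b
  zeroIff {zero} {zero} _ _ = ⇔.refl
  zeroIff {zero} {suc b} _ 1≤1∸b with () ← subst (1 ≤_) (0∸n≡0 b) 1≤1∸b
  zeroIff {suc a} {suc b} _ _ = zeroIff-pos (s≤s z≤n) (s≤s z≤n)

af-pointwise : ∀ {X : Set} {R : Rel X 0ℓ} → AlmostFull R → ∀ n →
               AlmostFull {Vec X n} (λ c d → ∀ l → R (lookup c l) (lookup d l))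
af-pointwise afR zero = now λ _ _ ()
af-pointwise {X} {R} afR (suc n) =
  af-mono (λ {c} {d} → cons {c} {d}) (af-∩ (af-on afR head) (af-on (af-pointwise afR n) tail))
  where
  cons : ∀ {c d : Vec X (suc n)} →
         R (head c) (head d) × (∀ l → R (lookup (tail c) l) (lookup (tail d) l)) →
         ∀ l → R (lookup c l) (lookup d l)
  cons {_ ∷ _} {_ ∷ _} (r , rs) zero = r
  cons {_ ∷ _} {_ ∷ _} (r , rs) (suc l) = rs l

private variable n : ℕ

inc : Vec ℕ n → Fin n → Vec ℕ n
inc c k = c [ k ]%= suc

dec : Vec ℕ n → Fin n → Vec ℕ n
dec c k = c [ k ]%= (_∸ 1)

kronecker : Fin n → Fin n → ℕ
kronecker l k with l ≟ k
... | yes _ = 1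
... | no _ = 0

kronecker-≡ : (k : Fin n) → kronecker k k ≡ 1
kronecker-≡ k with k ≟ k
... | yes _ = refl
... | no k≢k = ⊥-elim (k≢k refl)

kronecker-≢ : {l k : Fin n} → l ≢ k → kronecker l k ≡ 0
kronecker-≢ {l = l} {k} l≢k with l ≟ k
... | yes l≡k = ⊥-elim (l≢k l≡k)
... | no _ = refl

kronecker≤1 : (l k : Fin n) → kronecker l k ≤ 1
kronecker≤1 l k with l ≟ k
... | yes _ = ≤-refl
... | no _ = z≤n

kronecker≤ : {c : Vec ℕ n} {i : Fin n} → 1 ≤ lookup c i → ∀ l → kronecker l i ≤ lookup c l
kronecker≤ {i = i} 1≤ci l with l ≟ i
... | yes refl = 1≤ci
... | no _ = z≤n

lookup-inc : (c : Vec ℕ n) (k l : Fin n) → lookup (inc c k) l ≡ kronecker l k + lookup c l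
lookup-inc c k l with l ≟ k
... | yes refl = lookup∘updateAt l c
... | no l≢k = lookup∘updateAt′ l k l≢k c

lookup-dec : (c : Vec ℕ n) (k l : Fin n) → lookup (dec c k) l ≡ lookup c l ∸ kronecker l k
lookup-dec c k l with l ≟ k
... | yes refl = lookup∘updateAt l c
... | no l≢k = lookup∘updateAt′ l k l≢k c

vec-ext : {c d : Vec ℕ n} → (∀ l → lookup c l ≡ lookup d l) → c ≡ d
vec-ext c≗d = Pointwise-≡⇒≡ (ext c≗d)

inc-≥ : (c : Vec ℕ n) (k l : Fin n) → lookup c l ≤ lookup (inc c k) l
inc-≥ c k l rewrite lookup-inc c k l = m≤n+m _ _

inc-pos : (c : Vec ℕ n) (k : Fin n) → 1 ≤ lookup (inc c k) k
inc-pos c k = subst (1 ≤_) (sym (lookup∘updateAt k c)) (s≤s z≤n)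

inc-keeps-zero : (c : Vec ℕ n) {k l : Fin n} →
                 1 ≤ lookup c k → lookup c l ≡ 0 → lookup (inc c k) l ≡ 0
inc-keeps-zero c {k} {l} 1≤ck cl≡0 with l ≟ k
... | yes refl = ⊥-elim (n>0⇒n≢0 1≤ck cl≡0)
... | no l≢k = trans (lookup∘updateAt′ l k l≢k c) cl≡0

lookup-dec-≢ : (c : Vec ℕ n) {k l : Fin n} → l ≢ k → lookup (dec c k) l ≡ lookup c l
lookup-dec-≢ c {k} {l} l≢k = lookup∘updateAt′ l k l≢k c

dec-keeps-zero : (c : Vec ℕ n) {k l : Fin n} → lookup c l ≡ 0 → lookup (dec c k) l ≡ 0
dec-keeps-zero c {k} {l} cl≡0 rewrite lookup-dec c k l | cl≡0 = 0∸n≡0 (kronecker l k)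

dec-≢-≥ : ∀ {m} (c : Vec ℕ n) {k l : Fin n} → l ≢ k → m ≤ lookup c l → m ≤ lookup (dec c k) l
dec-≢-≥ c l≢k m≤cl = subst (_ ≤_) (sym (lookup-dec-≢ c l≢k)) m≤cl

dec-≥ : ∀ {m} (c : Vec ℕ n) k → suc m ≤ lookup c k → m ≤ lookup (dec c k) k
dec-≥ c k 1+m≤ck = subst (_ ≤_) (sym (lookup∘updateAt k c)) (∸-monoˡ-≤ 1 1+m≤ck)

dec-positive : (c : Vec ℕ n) {k l : Fin n} → 2 ≤ lookup c k → 1 ≤ lookup c l → 1 ≤ lookup (dec c k) l
dec-positive c {k} {l} 2≤ck 1≤cl with l ≟ k
... | yes refl = dec-≥ c l 2≤ck
... | no l≢k = dec-≢-≥ c l≢k 1≤cl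

dec-inc : (c : Vec ℕ n) (k : Fin n) → dec (inc c k) k ≡ c
dec-inc c k = trans (updateAt-updateAt k c) (updateAt-id-local k c refl)

inc-dec : (c : Vec ℕ n) (k : Fin n) → 1 ≤ lookup c k → inc (dec c k) k ≡ c
inc-dec c k 1≤ck = trans (updateAt-updateAt k c) (updateAt-id-local k c (m+[n∸m]≡n 1≤ck))

IncClosed : (Vec ℕ n → Set) → Set
IncClosed P = ∀ c k → 1 ≤ lookup c k → P c → P (inc c k)

inc-closed⇒upward : ∀ {n} {P : Vec ℕ n → Set} → IncClosed P → ∀ {c d} →
                    (∀ l → lookup c l ≤ lookup d l) → (∀ l → ZeroIff (lookup c l) (lookup d l)) →
                    P c → P d
inc-closed⇒upward {zero} _ {[]} {[]} _ _ p = p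
inc-closed⇒upward {suc n} {P} closed {x ∷ c} {y ∷ d} c≤d c~d p =
  inc-closed⇒upward (λ v k → closed (y ∷ v) (suc k)) (c≤d ∘ suc) (c~d ∘ suc)
                    (raise-head x (c≤d zero) (c~d zero) p)
  where
  raise-head : ∀ x → x ≤ y → ZeroIff x y → P (x ∷ c) → P (y ∷ c)
  raise-head zero _ x~y p = subst (λ v → P (v ∷ c)) (sym (Equivalence.to x~y refl)) p
  raise-head (suc x′) x≤y _ p = subst (λ v → P (v ∷ c)) (m∸n+n≡m x≤y) (raise (y ∸ suc x′))
    where
    raise : ∀ m → P ((m + suc x′) ∷ c)
    raise zero = p
    raise (suc m) = closed _ zero (≤-trans (s≤s z≤n) (m≤n+m (suc x′) m)) (raise m)

DecClosedAbove : ℕ → (Vec ℕ n → Set) → Set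
DecClosedAbove N P = ∀ c k → N < lookup c k → P c → P (dec c k)

clamp : ℕ → Vec ℕ n → Vec ℕ n
clamp N = map (_⊓ N)

dec-closed⇒clamp : ∀ {n N} {P : Vec ℕ n → Set} → DecClosedAbove N P → ∀ {c} → P c → P (clamp N c)
dec-closed⇒clamp {zero} _ {[]} p = p
dec-closed⇒clamp {suc n} {N} {P} closed {x ∷ c} p =
  dec-closed⇒clamp (λ v k → closed (x ⊓ N ∷ v) (suc k)) (lower-head x p)
  where
  lower-head : ∀ x → P (x ∷ c) → P (x ⊓ N ∷ c)
  lower-head zero p = p
  lower-head (suc x) p with suc x ≤? N
  ... | yes x<N = subst (λ v → P (v ∷ c)) (sym (m≤n⇒m⊓n≡m x<N)) p
  ... | no x≮N =
    subst (λ v → P (v ∷ c)) (trans (m≥n⇒m⊓n≡n N≤x) (sym (m≥n⇒m⊓n≡n (m≤n⇒m≤1+n N≤x))))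
          (lower-head x (closed (suc x ∷ c) zero (≰⇒> x≮N) p))
    where
    N≤x : N ≤ x
    N≤x = ≤-pred (≰⇒> x≮N)

clamp-≤ : ∀ N (c : Vec ℕ n) l → lookup (clamp N c) l ≤ lookup c l
clamp-≤ N c l rewrite lookup-map l (_⊓ N) c = m⊓n≤m (lookup c l) N

clamp-≤-bound : ∀ N (c : Vec ℕ n) l → lookup (clamp N c) l ≤ N
clamp-≤-bound N c l rewrite lookup-map l (_⊓ N) c = m⊓n≤n (lookup c l) N

clamp-zeroIff : ∀ {N} → 1 ≤ N → (c : Vec ℕ n) → ∀ l → ZeroIff (lookup (clamp N c) l) (lookup c l)
clamp-zeroIff {N = N} 1≤N c l rewrite lookup-map l (_⊓ N) c with lookup c l
... | zero = ⇔.refl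
... | suc x = zeroIff-pos (⊓-glb (s≤s z≤n) 1≤N) (s≤s z≤n)

vectorsUpTo : ℕ → ∀ n → List (Vec ℕ n)
vectorsUpTo N zero = [] ∷ []
vectorsUpTo N (suc n) = cartesianProductWith _∷_ (upTo (suc N)) (vectorsUpTo N n)

∈-vectorsUpTo : ∀ N {n} (c : Vec ℕ n) → (∀ l → lookup c l ≤ N) → c ∈ₗ vectorsUpTo N n
∈-vectorsUpTo N [] _ = here refl
∈-vectorsUpTo N (x ∷ c) c≤N =
  ∈-cartesianProductWith⁺ _∷_ (∈-upTo⁺ (s≤s (c≤N zero))) (∈-vectorsUpTo N c (c≤N ∘ suc))

module _ {nA nB : ℕ} (A : Template nA nB nA) (B : Template nA nB nB) where
  open CounterSystem A B

  private variable
    q q′ : Fin nA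
    c d y : Vec ℕ nB
    i j k l : Fin nB
    g : Guard nA nB

  lookup-move : ∀ c i j l → lookup (move c i j) l ≡ kronecker l j + (lookup c l ∸ kronecker l i)
  lookup-move c i j l =
    trans (lookup-inc (dec c i) j l) (cong (kronecker l j +_) (lookup-dec c i l))

  lookup-move-source : i ≢ j → lookup (move c i j) i ≡ lookup c i ∸ 1
  lookup-move-source {i} {j} {c} i≢j =
    trans (lookup∘updateAt′ i j i≢j (dec c i)) (lookup∘updateAt i c)

  lookup-move-target : i ≢ j → lookup (move c i j) j ≡ suc (lookup c j)
  lookup-move-target {i} {j} {c} i≢j =
    trans (lookup∘updateAt j (dec c i)) (cong suc (lookup∘updateAt′ j i (i≢j ∘ sym) c))

  lookup-move-other : l ≢ i → l ≢ j → lookup (move c i j) l ≡ lookup c l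
  lookup-move-other {l} {i} {j} {c} l≢i l≢j =
    trans (lookup∘updateAt′ l j l≢j (dec c i)) (lookup∘updateAt′ l i l≢i c)

  lookup-move-≥ : l ≢ i → lookup c l ≤ lookup (move c i j) l
  lookup-move-≥ {l} {i} {c} {j} l≢i rewrite lookup-move c i j l | kronecker-≢ l≢i = m≤n+m _ _

  lookup-move-source-pred : ∀ c i j → lookup c i ∸ 1 ≤ lookup (move c i j) i
  lookup-move-source-pred c i j rewrite lookup-move c i j i | kronecker-≡ i = m≤n+m _ _

  move-target-pos : ∀ c → i ≢ j → 1 ≤ lookup (move c i j) j
  move-target-pos c i≢j = subst (1 ≤_) (sym (lookup-move-target {c = c} i≢j)) (s≤s z≤n)

  move-conserves : ∀ c → i ≢ j → 1 ≤ lookup c i →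
                   lookup (move c i j) i + lookup (move c i j) j ≡ lookup c i + lookup c j
  move-conserves {i} {j} c i≢j 1≤ci = begin
    lookup (move c i j) i + lookup (move c i j) j
      ≡⟨ cong₂ _+_ (lookup-move-source {c = c} i≢j) (lookup-move-target {c = c} i≢j) ⟩
    lookup c i ∸ 1 + suc (lookup c j)  ≡⟨ +-suc _ _ ⟩
    suc (lookup c i ∸ 1) + lookup c j  ≡⟨ cong (_+ lookup c j) (m+[n∸m]≡n 1≤ci) ⟩
    lookup c i + lookup c j            ∎
    where open ≡-Reasoning

  move-inc : 1 ≤ lookup c i → move (inc c k) i j ≡ inc (move c i j) k
  move-inc {c} {i} {k} {j} 1≤ci = vec-ext pointwise
    where
    open ≡-Reasoning
    pointwise : ∀ l → lookup (move (inc c k) i j) l ≡ lookup (inc (move c i j) k) l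
    pointwise l = begin
      lookup (move (inc c k) i j) l          ≡⟨ lookup-move (inc c k) i j l ⟩
      κ j + (lookup (inc c k) l ∸ κ i)       ≡⟨ cong (λ v → κ j + (v ∸ κ i)) (lookup-inc c k l) ⟩
      κ j + (κ k + lookup c l ∸ κ i)         ≡⟨ cong (κ j +_) (+-∸-assoc (κ k) κi≤) ⟩
      κ j + (κ k + (lookup c l ∸ κ i))       ≡⟨ x∙yz≈y∙xz (κ j) (κ k) _ ⟩
      κ k + (κ j + (lookup c l ∸ κ i))       ≡⟨ cong (κ k +_) (lookup-move c i j l) ⟨
      κ k + lookup (move c i j) l            ≡⟨ lookup-inc (move c i j) k l ⟨
      lookup (inc (move c i j) k) l          ∎
      where
      κ : Fin nB → ℕ
      κ = kronecker l
      κi≤ : κ i ≤ lookup c l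
      κi≤ = kronecker≤ {c = c} 1≤ci l

  move-dec : 2 ≤ lookup c k → move (dec c k) i j ≡ dec (move c i j) k
  move-dec {c} {k} {i} {j} 2≤ck = vec-ext pointwise
    where
    open ≡-Reasoning
    ∸-comm : ∀ x a b → x ∸ a ∸ b ≡ x ∸ b ∸ a
    ∸-comm x a b = trans (∸-+-assoc x a b) (trans (cong (x ∸_) (+-comm a b)) (sym (∸-+-assoc x b a)))
    pointwise : ∀ l → lookup (move (dec c k) i j) l ≡ lookup (dec (move c i j) k) l
    pointwise l = begin
      lookup (move (dec c k) i j) l          ≡⟨ lookup-move (dec c k) i j l ⟩
      κ j + (lookup (dec c k) l ∸ κ i)       ≡⟨ cong (λ v → κ j + (v ∸ κ i)) (lookup-dec c k l) ⟩
      κ j + (lookup c l ∸ κ k ∸ κ i)         ≡⟨ cong (κ j +_) (∸-comm (lookup c l) (κ k) (κ i)) ⟩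
      κ j + (lookup c l ∸ κ i ∸ κ k)         ≡⟨ +-∸-assoc (κ j) κk≤ ⟨
      κ j + (lookup c l ∸ κ i) ∸ κ k         ≡⟨ cong (_∸ κ k) (lookup-move c i j l) ⟨
      lookup (move c i j) l ∸ κ k            ≡⟨ lookup-dec (move c i j) k l ⟨
      lookup (dec (move c i j) k) l          ∎
      where
      κ : Fin nB → ℕ
      κ = kronecker l
      κk≤ : κ k ≤ lookup c l ∸ κ i
      κk≤ with l ≟ k
      ... | yes refl = ≤-trans (∸-monoˡ-≤ 1 2≤ck) (∸-monoʳ-≤ (lookup c l) (kronecker≤1 l i))
      ... | no _ = z≤n

  ≲₀-refl : ∀ s → s ≲₀ s
  ≲₀-refl _ = refl , (λ _ → ≤-refl) , (λ _ → ⇔.refl)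

  ≲₀-trans : ∀ s t u → s ≲₀ t → t ≲₀ u → s ≲₀ u
  ≲₀-trans _ _ _ (refl , c≤d , c~d) (refl , d≤e , d~e) =
    refl , (λ l → ≤-trans (c≤d l) (d≤e l)) , (λ l → ⇔.trans (c~d l) (d~e l))

  af-≲₀ : AlmostFull _≲₀_
  af-≲₀ = af-mono (λ {s} {r} → split {s} {r})
                  (af-∩ (af-on af-≡ proj₁) (af-on (af-pointwise af-≤∩zeroIff nB) proj₂))
    where
    split : ∀ {s r} → proj₁ s ≡ proj₁ r ×
            (∀ l → (_≤_ ∩ ZeroIff) (lookup (proj₂ s) l) (lookup (proj₂ r) l)) → s ≲₀ r
    split {_ , _} {_ , _} (q≡q′ , c≤∩~d) = q≡q′ , proj₁ ∘ c≤∩~d , proj₂ ∘ c≤∩~d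

  ≲₀-wqo : IsWQO _≲₀_
  ≲₀-wqo = ≲₀-refl , ≲₀-trans , af-good af-≲₀

  ≲₀-inc : ∀ c k → 1 ≤ lookup c k → (q , c) ≲₀ (q , inc c k)
  ≲₀-inc c k 1≤ck = refl , inc-≥ c k , zeros
    where
    zeros : ∀ l → ZeroIff (lookup c l) (lookup (inc c k) l)
    zeros l with l ≟ k
    ... | yes refl = zeroIff-pos 1≤ck (≤-trans 1≤ck (inc-≥ c k l))
    ... | no l≢k rewrite lookup∘updateAt′ l k {suc} l≢k c = ⇔.refl

  ↑₀-inc : ∀ {R} q c k → 1 ≤ lookup c k → ↑₀ R (q , c) → ↑₀ R (q , inc c k)
  ↑₀-inc q c k 1≤ck (b , b∈R , b≲s) =
    b , b∈R , ≲₀-trans b (q , c) (q , inc c k) b≲s (≲₀-inc c k 1≤ck)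

  Enabled : Fin nB → Guard nA nB → Fin nA → Vec ℕ nB → Set
  Enabled i g q c =
    q ∈ proj₁ g ⊎ (∃[ l ] (l ∈ proj₂ g × l ≢ i × 1 ≤ lookup c l)) ⊎ (i ∈ proj₂ g × 2 ≤ lookup c i)

  EnabledByOthers : Fin nB → Guard nA nB → Fin nA → Vec ℕ nB → Set
  EnabledByOthers i g q c = q ∈ proj₁ g ⊎ ∃[ l ] (l ∈ proj₂ g × l ≢ i × 1 ≤ lookup c l)

  -- A record rather than a function type, so that Agda can infer c and d.
  record PositiveOff (i : Fin nB) (c d : Vec ℕ nB) : Set where
    constructor positiveOff
    field positive : ∀ l → l ≢ i → 1 ≤ lookup c l → 1 ≤ lookup d l
  open PositiveOff

  ≤⇒positiveOff : (∀ l → lookup c l ≤ lookup d l) → PositiveOff i c d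
  ≤⇒positiveOff c≤d = positiveOff λ l _ 1≤cl → ≤-trans 1≤cl (c≤d l)

  byOthers-mono : PositiveOff i c d → EnabledByOthers i g q c → EnabledByOthers i g q d
  byOthers-mono _ (inj₁ q∈g) = inj₁ q∈g
  byOthers-mono pos (inj₂ (l , l∈g , l≢i , 1≤cl)) =
    inj₂ (l , l∈g , l≢i , positive pos l l≢i 1≤cl)

  enabled-mono : PositiveOff i c d → (2 ≤ lookup c i → 2 ≤ lookup d i) →
                 Enabled i g q c → Enabled i g q d
  enabled-mono _ _ (inj₁ q∈g) = inj₁ q∈g
  enabled-mono pos _ (inj₂ (inj₁ (l , l∈g , l≢i , 1≤cl))) =
    inj₂ (inj₁ (l , l∈g , l≢i , positive pos l l≢i 1≤cl))
  enabled-mono _ two (inj₂ (inj₂ (i∈g , 2≤ci))) = inj₂ (inj₂ (i∈g , two 2≤ci))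

  byOthers-≤ : ∀ c d → (∀ l → lookup c l ≤ lookup d l) →
               EnabledByOthers i g q c → EnabledByOthers i g q d
  byOthers-≤ {i} c d c≤d = byOthers-mono {i = i} {c = c} {d = d} (≤⇒positiveOff c≤d)

  enabled-≤ : ∀ c d → (∀ l → lookup c l ≤ lookup d l) → Enabled i g q c → Enabled i g q d
  enabled-≤ {i} c d c≤d =
    enabled-mono {i = i} {c = c} {d = d} (≤⇒positiveOff c≤d) (λ 2≤ci → ≤-trans 2≤ci (c≤d i))

  byOthers⇒enabled : EnabledByOthers i g q c → Enabled i g q c
  byOthers⇒enabled (inj₁ q∈g) = inj₁ q∈g
  byOthers⇒enabled (inj₂ other) = inj₂ (inj₁ other)

  enabled⇒byOthers : lookup c i ≤ 1 → Enabled i g q c → EnabledByOthers i g q c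
  enabled⇒byOthers _ (inj₁ q∈g) = inj₁ q∈g
  enabled⇒byOthers _ (inj₂ (inj₁ other)) = inj₂ other
  enabled⇒byOthers ci≤1 (inj₂ (inj₂ (_ , 2≤ci))) = ⊥-elim (1+n≰n (≤-trans 2≤ci ci≤1))

  based-step : 1 ≤ lookup c i → Enabled i g q c → BasedOn (i , g , j) (q , c) (q , move c i j)
  based-step 1≤ci en = refl , 1≤ci , refl , en

  based⇒Δ : ∀ {t s s′} → t ∈ₗ δ B → BasedOn t s s′ → Δ s s′
  based⇒Δ {t} t∈δ b = inj₂ (t , t∈δ , b)

  -- Compatibility

  move-≲₀ : i ≢ j → (q , c) ≲₀ (q′ , d) → ZeroIff (lookup c i ∸ 1) (lookup d i ∸ 1) →
            (q , move c i j) ≲₀ (q′ , move d i j)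
  move-≲₀ {i} {j} {c = c} {d = d} i≢j (q≡q′ , c≤d , c~d) ci-1~di-1 = q≡q′ , ≤-move , ~-move
    where
    ≤-move : ∀ l → lookup (move c i j) l ≤ lookup (move d i j) l
    ≤-move l rewrite lookup-move c i j l | lookup-move d i j l =
      +-monoʳ-≤ (kronecker l j) (∸-monoˡ-≤ (kronecker l i) (c≤d l))
    ~-move : ∀ l → ZeroIff (lookup (move c i j) l) (lookup (move d i j) l)
    ~-move l with l ≟ i | l ≟ j
    ... | yes refl | _ rewrite lookup-move-source {c = c} i≢j | lookup-move-source {c = d} i≢j = ci-1~di-1
    ... | no _ | yes refl rewrite lookup-move-target {c = c} i≢j | lookup-move-target {c = d} i≢j =
      zeroIff-pos (s≤s z≤n) (s≤s z≤n)
    ... | no l≢i | no l≢j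
      rewrite lookup-move-other {c = c} l≢i l≢j | lookup-move-other {c = d} l≢i l≢j = c~d l

  Drained : Fin nB → Fin nB → Vec ℕ nB → Vec ℕ nB → Set
  Drained i j d y =
    lookup y i ≡ 0 × lookup y j ≡ lookup d i + lookup d j ×
    (∀ l → l ≢ i → l ≢ j → lookup y l ≡ lookup d l)

  drain : i ≢ j → (i , g , j) ∈ₗ δ B → EnabledByOthers i g q d →
          ∃[ y ] (Star Δ (q , d) (q , y) × Drained i j d y)
  drain {i} {j} {g} {q} {d} i≢j t∈δ = go (lookup d i) d refl
    where
    go : ∀ n d → lookup d i ≡ n → EnabledByOthers i g q d →
         ∃[ y ] (Star Δ (q , d) (q , y) × Drained i j d y)
    go zero d di≡0 _ = d , ε , di≡0 , cong (_+ lookup d j) (sym di≡0) , λ _ _ _ → refl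
    go (suc n) d di≡1+n en
      with go n (move d i j) (trans (lookup-move-source {c = d} i≢j) (cong (_∸ 1) di≡1+n))
              (byOthers-mono {c = d} {d = move d i j}
                 (positiveOff λ l l≢i 1≤dl → ≤-trans 1≤dl (lookup-move-≥ {c = d} {j} l≢i)) en)
    ... | y , steps , yi≡0 , yj≡ , y≡ =
      y , based⇒Δ t∈δ (based-step 1≤di (byOthers⇒enabled {c = d} en)) ◅ steps ,
      yi≡0 , trans yj≡ (move-conserves d i≢j 1≤di) ,
      λ l l≢i l≢j → trans (y≡ l l≢i l≢j) (lookup-move-other {c = d} l≢i l≢j)
      where
      1≤di : 1 ≤ lookup d i
      1≤di = subst (1 ≤_) (sym di≡1+n) (s≤s z≤n)

  move-≲₀-drained : i ≢ j → (q , c) ≲₀ (q , d) → lookup c i ≤ 1 → 1 ≤ lookup d i → Drained i j d y →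
                    (q , move c i j) ≲₀ (q , y)
  move-≲₀-drained {i} {j} {c = c} {d} {y} i≢j (_ , c≤d , c~d) ci≤1 1≤di (yi≡0 , yj≡di+dj , y≡d) =
    refl , ≤-drained , ~-drained
    where
    ci-1≡0 : lookup c i ∸ 1 ≡ 0
    ci-1≡0 = m≤n⇒m∸n≡0 ci≤1
    1+cj≤yj : suc (lookup c j) ≤ lookup y j
    1+cj≤yj = subst (suc (lookup c j) ≤_) (sym yj≡di+dj) (+-mono-≤ 1≤di (c≤d j))
    ≤-drained : ∀ l → lookup (move c i j) l ≤ lookup y l
    ≤-drained l with l ≟ i | l ≟ j
    ... | yes refl | _ rewrite lookup-move-source {c = c} i≢j | ci-1≡0 = z≤n
    ... | no _ | yes refl rewrite lookup-move-target {c = c} i≢j = 1+cj≤yj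
    ... | no l≢i | no l≢j rewrite lookup-move-other {c = c} l≢i l≢j | y≡d l l≢i l≢j = c≤d l
    ~-drained : ∀ l → ZeroIff (lookup (move c i j) l) (lookup y l)
    ~-drained l with l ≟ i | l ≟ j
    ... | yes refl | _ rewrite lookup-move-source {c = c} i≢j | ci-1≡0 | yi≡0 = ⇔.refl
    ... | no _ | yes refl rewrite lookup-move-target {c = c} i≢j =
      zeroIff-pos (s≤s z≤n) (≤-trans (s≤s z≤n) 1+cj≤yj)
    ... | no l≢i | no l≢j rewrite lookup-move-other {c = c} l≢i l≢j | y≡d l l≢i l≢j = c~d l

  based-compatible : ∀ {t s s′ r} → t ∈ₗ δ B → BasedOn t s s′ → s ≲₀ r →
                     ∃[ r′ ] (s′ ≲₀ r′ × Star Δ r r′)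
  based-compatible {i , g , j} {q , c} {r = _ , d} t∈δ (refl , 1≤ci , refl , en)
                   s≲r@(refl , c≤d , _) with i ≟ j
  ... | yes refl rewrite inc-dec c i 1≤ci = (q , d) , s≲r , ε
  ... | no i≢j with ∸1-zeroIff⊎straddle (c≤d i)
  ...   | inj₁ ci-1~di-1 =
    (q , move d i j) , move-≲₀ {c = c} {d = d} i≢j s≲r ci-1~di-1 ,
    based⇒Δ t∈δ (based-step (≤-trans 1≤ci (c≤d i)) (enabled-≤ c d c≤d en)) ◅ ε
  ...   | inj₂ (ci≤1 , 2≤di)
    with drain {d = d} i≢j t∈δ (byOthers-≤ c d c≤d (enabled⇒byOthers {c = c} ci≤1 en))
  ...     | y , steps , drained =
    (q , y) , move-≲₀-drained {c = c} {d = d} {y = y} i≢j s≲r ci≤1 (≤-trans (s≤s z≤n) 2≤di) drained ,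
    steps

  compatible : Compatible _≲₀_
  compatible (q , c) (q′ , _) (_ , d) (inj₁ (refl , g , t∈δ , l , l∈g , 1≤cl)) (refl , c≤d , c~d) =
    (q′ , d) , (refl , c≤d , c~d) , inj₁ (refl , g , t∈δ , l , l∈g , ≤-trans 1≤cl (c≤d l)) ◅ ε
  compatible _ _ _ (inj₂ (_ , t∈δ , b)) s≲r = based-compatible t∈δ b s≲r

  Chain : Fin nB × Guard nA nB × Fin nB → S → S → Set
  Chain t = TransClosure (BasedOn t)

  chain-source-pos : ∀ {t s′} → Chain t (q , c) s′ → 1 ≤ lookup c (proj₁ t)
  chain-source-pos [ _ , 1≤ci , _ ]⁺ = 1≤ci
  chain-source-pos ((_ , 1≤ci , _) ∷ _) = 1≤ci

  chain-last : ∀ {t s s′} → Chain t s s′ → ∃[ w ] BasedOn t w s′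
  chain-last {s = s} [ b ]⁺ = s , b
  chain-last (_ ∷ bs) = chain-last bs

  chain-off-source-≤ : Chain (i , g , j) (q , c) (q′ , y) → ∀ l → l ≢ i → lookup c l ≤ lookup y l
  chain-off-source-≤ {c = c} [ refl , _ , refl , _ ]⁺ l l≢i = lookup-move-≥ {c = c} l≢i
  chain-off-source-≤ {c = c} ((refl , _ , refl , _) ∷ bs) l l≢i =
    ≤-trans (lookup-move-≥ {c = c} l≢i) (chain-off-source-≤ bs l l≢i)

  chain-self : Chain (i , g , i) (q , c) (q′ , y) → y ≡ c × 1 ≤ lookup c i
  chain-self {c = c} [ refl , 1≤ci , refl , _ ]⁺ = inc-dec c _ 1≤ci , 1≤ci
  chain-self {i = i} {c = c} ((refl , 1≤ci , refl , _) ∷ bs) with chain-self bs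
  ... | y≡c , _ rewrite inc-dec c i 1≤ci = y≡c , 1≤ci

  chain-self-cond : Chain (i , g , i) (q , c) (q′ , y) → ¬ (lookup c i ≡ 0 ⊎ lookup y i ≡ 0)
  chain-self-cond ch cond with chain-self ch
  chain-self-cond ch (inj₁ ci≡0) | _ , 1≤ci = n>0⇒n≢0 1≤ci ci≡0
  chain-self-cond ch (inj₂ yi≡0) | refl , 1≤ci = n>0⇒n≢0 1≤ci yi≡0

  chain-source-< : i ≢ j → Chain (i , g , j) (q , c) (q′ , y) → lookup y i < lookup c i
  chain-source-< {c = c} i≢j [ refl , 1≤ci , refl , _ ]⁺ =
    subst (_< lookup c _) (sym (lookup-move-source {c = c} i≢j)) (∸1< 1≤ci)
  chain-source-< {c = c} i≢j ((refl , 1≤ci , refl , _) ∷ bs) =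
    <-≤-trans (chain-source-< i≢j bs)
              (subst (_≤ lookup c _) (sym (lookup-move-source {c = c} i≢j)) (m∸n≤m _ 1))

  chain-conserves : i ≢ j → Chain (i , g , j) (q , c) (q′ , y) →
                    lookup y i + lookup y j ≡ lookup c i + lookup c j
  chain-conserves {i} {j} {c = c} i≢j [ refl , 1≤ci , refl , _ ]⁺ = move-conserves c i≢j 1≤ci
  chain-conserves {i} {j} {c = c} i≢j ((refl , 1≤ci , refl , _) ∷ bs) =
    trans (chain-conserves i≢j bs) (move-conserves c i≢j 1≤ci)

  chain-target-pos : i ≢ j → Chain (i , g , j) (q , c) (q′ , y) → 1 ≤ lookup y j
  chain-target-pos i≢j ch with chain-last ch
  ... | (_ , w) , (refl , _ , refl , _) = move-target-pos w i≢j

  -- Upward closure of opred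

  based-inc : ∀ {t} → BasedOn t (q , c) (q′ , d) → BasedOn t (q , inc c k) (q′ , inc d k)
  based-inc {c = c} {k = k} {t = i , g , j} (refl , 1≤ci , refl , en) =
    refl , ≤-trans 1≤ci (inc-≥ c k i) , sym (move-inc 1≤ci) ,
    enabled-≤ c (inc c k) (inc-≥ c k) en

  chain-inc : ∀ {t} → Chain t (q , c) (q′ , d) → Chain t (q , inc c k) (q′ , inc d k)
  chain-inc [ b ]⁺ = [ based-inc b ]⁺
  chain-inc (_∷_ {y = _ , _} b bs) = based-inc b ∷ chain-inc bs

  chain-vanishing : Chain (i , g , j) (q , c) (q′ , y) → 1 ≤ lookup c k → lookup y k ≡ 0 → k ≡ i × i ≢ j
  chain-vanishing {i} {j = j} {k = k} ch 1≤ck yk≡0 with k ≟ i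
  ... | no k≢i = ⊥-elim (n>0⇒n≢0 (≤-trans 1≤ck (chain-off-source-≤ ch k k≢i)) yk≡0)
  ... | yes refl with i ≟ j
  ...   | no i≢j = refl , i≢j
  ...   | yes refl with chain-self ch
  ...     | refl , _ = ⊥-elim (n>0⇒n≢0 1≤ck yk≡0)

  -- The extra process is moved by one more step, enabled by the other processes because the
  -- last step of the chain emptied q_i.
  chain-extend-inc-source : i ≢ j → Chain (i , g , j) (q , c) (q′ , y) → lookup y i ≡ 0 →
                            Chain (i , g , j) (q , inc c i) (q′ , inc y j)
  chain-extend-inc-source {i} {j} {g} {q′ = q′} i≢j ch yi≡0 with chain-last ch
  ... | (_ , w) , (refl , _ , refl , en) = chain-inc ch ∷ʳ last-step
    where
    v : Vec ℕ nB
    v = move w i j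
    wi≤1 : lookup w i ≤ 1
    wi≤1 = m∸n≡0⇒m≤n (trans (sym (lookup-move-source {c = w} i≢j)) yi≡0)
    last-step : BasedOn (i , g , j) (q′ , inc v i) (q′ , inc v j)
    last-step =
      refl , inc-pos v i , cong (λ u → inc u j) (sym (dec-inc v i)) ,
      byOthers⇒enabled {c = inc v i} (byOthers-mono {c = w} {d = inc v i}
        (positiveOff λ l l≢i 1≤wl → ≤-trans 1≤wl (≤-trans (lookup-move-≥ {c = w} l≢i) (inc-≥ v i l)))
        (enabled⇒byOthers {c = w} wi≤1 en))

  opred-vanishing : ∀ {R t} → t ∈ₗ δ B → Chain t (q , c) (q′ , y) → ↑₀ R (q′ , y) →
                    1 ≤ lookup c k → lookup y k ≡ 0 → opred (↑₀ R) (q , inc c k)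
  opred-vanishing {q′ = q′} {y = y} {t = i , g , j} t∈δ ch up 1≤ck yk≡0 with chain-vanishing ch 1≤ck yk≡0
  ... | refl , i≢j =
    inj₂ (_ , ↑₀-inc q′ y j (chain-target-pos i≢j ch) up , (i , g , j) , t∈δ ,
          chain-extend-inc-source i≢j ch yk≡0 , inj₂ (trans (lookup∘updateAt′ i j i≢j y) yk≡0))

  opred-inc : ∀ R → IncClosed (λ c → opred (↑₀ R) (q , c))
  opred-inc R c k 1≤ck (inj₁ ((q′ , _) , up , inj₁ (refl , g , t∈δ , l , l∈g , 1≤cl))) =
    inj₁ (_ , ↑₀-inc q′ c k 1≤ck up , inj₁ (refl , g , t∈δ , l , l∈g , ≤-trans 1≤cl (inc-≥ c k l)))
  opred-inc {q} R c k 1≤ck (inj₁ ((_ , m) , up , inj₂ (_ , t∈δ , b@(refl , _)))) with 1 ≤? lookup m k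
  ... | yes 1≤mk = inj₁ (_ , ↑₀-inc q m k 1≤mk up , based⇒Δ t∈δ (based-inc b))
  ... | no 1≰mk = opred-vanishing t∈δ [ b ]⁺ up 1≤ck (n<1⇒n≡0 (≰⇒> 1≰mk))
  opred-inc R c k 1≤ck (inj₂ ((q′ , y) , up , t , t∈δ , ch , cond)) with 1 ≤? lookup y k
  ... | yes 1≤yk =
    inj₂ (_ , ↑₀-inc q′ y k 1≤yk up , t , t∈δ , chain-inc ch ,
          ⊎-map (inc-keeps-zero c 1≤ck) (inc-keeps-zero y 1≤yk) cond)
  ... | no 1≰yk = opred-vanishing t∈δ ch up 1≤ck (n<1⇒n≡0 (≰⇒> 1≰yk))

  opred-upward : ∀ R s r → opred (↑₀ R) s → s ≲₀ r → opred (↑₀ R) r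
  opred-upward R (q , c) (_ , d) op (refl , c≤d , c~d) = inc-closed⇒upward (opred-inc R) c≤d c~d op

  -- Removing processes from a large counter

  based-dec : 2 ≤ lookup c k → (2 ≤ lookup c i → 2 ≤ lookup (dec c k) i) →
              BasedOn (i , g , j) (q , c) (q′ , d) → BasedOn (i , g , j) (q , dec c k) (q′ , dec d k)
  based-dec {c = c} {k} {i} 2≤ck self (refl , 1≤ci , refl , en) =
    refl , dec-positive c 2≤ck 1≤ci , sym (move-dec 2≤ck) ,
    enabled-mono {i = i} {c = c} {d = dec c k} (positiveOff λ _ _ → dec-positive c 2≤ck) self en

  chain-dec-other : k ≢ i → 2 ≤ lookup c k → Chain (i , g , j) (q , c) (q′ , y) →
                    Chain (i , g , j) (q , dec c k) (q′ , dec y k)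
  chain-dec-other {c = c} k≢i 2≤ck [ b ]⁺ = [ based-dec 2≤ck (dec-≢-≥ c (k≢i ∘ sym)) b ]⁺
  chain-dec-other {c = c} k≢i 2≤ck (b@(refl , _ , refl , _) ∷ bs) =
    based-dec 2≤ck (dec-≢-≥ c (k≢i ∘ sym)) b ∷
    chain-dec-other k≢i (≤-trans 2≤ck (lookup-move-≥ {c = c} k≢i)) bs

  based-dec-source : BasedOn (i , g , j) (q , c) (q′ , d) → 3 ≤ lookup c i →
                     BasedOn (i , g , j) (q , dec c i) (q′ , dec d i)
  based-dec-source {i} {c = c} b 3≤ci = based-dec (≤-trans (n≤1+n 2) 3≤ci) (λ _ → dec-≥ c i 3≤ci) b

  chain-dec-source : i ≢ j → 2 ≤ lookup y i → Chain (i , g , j) (q , c) (q′ , y) →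
                     Chain (i , g , j) (q , dec c i) (q′ , dec y i)
  chain-dec-source i≢j 2≤yi ch with ≤-<-trans 2≤yi (chain-source-< i≢j ch)
  chain-dec-source i≢j 2≤yi [ b ]⁺ | 3≤ci = [ based-dec-source b 3≤ci ]⁺
  chain-dec-source i≢j 2≤yi (b@(refl , _ , refl , _) ∷ bs) | 3≤ci =
    based-dec-source b 3≤ci ∷ chain-dec-source i≢j 2≤yi bs

  -- The chain without its first step, started from c − u_i, reaches y − u_j; 1 ≤ c(j) keeps
  -- the guard of the second step satisfied.
  chain-skip : i ≢ j → 1 ≤ lookup c j →
               BasedOn (i , g , j) (q , c) (q , d) → Chain (i , g , j) (q , d) (q′ , y) →
               Chain (i , g , j) (q , dec c i) (q′ , dec y j)
  chain-skip {i} {j} {c} {g} {q} {q′ = q′} i≢j 1≤cj (refl , _ , refl , _) [ refl , 1≤mi , refl , en ]⁺ =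
    [ skipped ]⁺
    where
    m : Vec ℕ nB
    m = move c i j
    ci-1≡mi : lookup (dec c i) i ≡ lookup m i
    ci-1≡mi = trans (lookup∘updateAt i c) (sym (lookup-move-source {c = c} i≢j))
    2≤ci : 2 ≤ lookup c i
    2≤ci = <∸1⇒< (subst (0 <_) (lookup-move-source {c = c} i≢j) 1≤mi)
    positive-off-source : ∀ l → l ≢ i → 1 ≤ lookup m l → 1 ≤ lookup (dec c i) l
    positive-off-source l l≢i 1≤ml with l ≟ j
    ... | yes refl = subst (1 ≤_) (sym (lookup-dec-≢ c l≢i)) 1≤cj
    ... | no l≢j = subst (1 ≤_) (trans (lookup-move-other {c = c} l≢i l≢j) (sym (lookup-dec-≢ c l≢i))) 1≤ml
    skipped : BasedOn (i , g , j) (q , dec c i) (q′ , dec (move m i j) j)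
    skipped =
      refl , subst (1 ≤_) (sym ci-1≡mi) 1≤mi , trans (dec-inc (dec m i) j) (sym (move-dec 2≤ci)) ,
      enabled-mono {i = i} {c = m} {d = dec c i} (positiveOff positive-off-source) (subst (2 ≤_) (sym ci-1≡mi)) en
  chain-skip {i} {j} {c} i≢j _ b@(refl , _ , refl , _) (_∷_ {y = _ , _} b′@(refl , _ , refl , _) bs) =
    based-dec-source b 3≤ci ∷ chain-skip i≢j (move-target-pos c i≢j) b′ bs
    where
    m : Vec ℕ nB
    m = move c i j
    2≤mi : 2 ≤ lookup m i
    2≤mi = <∸1⇒< (subst (0 <_) (lookup-move-source {c = m} i≢j) (chain-source-pos bs))
    3≤ci : 3 ≤ lookup c i
    3≤ci = <∸1⇒< (subst (1 <_) (lookup-move-source {c = c} i≢j) 2≤mi)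

  entryBound : List S → ℕ
  entryBound R = max 0 (concatMap (toList ∘ proj₂) R)

  entry≤bound : ∀ {R r} → r ∈ₗ R → ∀ l → lookup (proj₂ r) l ≤ entryBound R
  entry≤bound {R} {r} r∈R l =
    All.lookup (xs≤max 0 (concatMap (toList ∘ proj₂) R))
               (∈-concatMap⁺ (toList ∘ proj₂) (lose r∈R (∈-toList⁺ (∈-lookup l (proj₂ r)))))

  ↑₀-dec : ∀ R q c k → suc (entryBound R) < lookup c k → ↑₀ R (q , c) → ↑₀ R (q , dec c k)
  ↑₀-dec R q c k big (r@(_ , b) , r∈R , refl , b≤c , b~c) = r , r∈R , refl , b≤dec , b~dec
    where
    b≤dec : ∀ l → lookup b l ≤ lookup (dec c k) l
    b≤dec l with l ≟ k
    ... | yes refl = ≤-trans (entry≤bound r∈R l) (≤-trans (n≤1+n _) (dec-≥ c l big))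
    ... | no l≢k = subst (lookup b l ≤_) (sym (lookup-dec-≢ c l≢k)) (b≤c l)
    b~dec : ∀ l → ZeroIff (lookup b l) (lookup (dec c k) l)
    b~dec l with l ≟ k
    ... | yes refl = zeroIff-pos (zeroIff-pos⇒ (⇔.sym (b~c l)) (≤-trans (s≤s z≤n) big))
                                 (dec-positive c (≤-trans (s≤s (s≤s z≤n)) big) (≤-trans (s≤s z≤n) big))
    ... | no l≢k = subst (ZeroIff (lookup b l)) (sym (lookup-dec-≢ c l≢k)) (b~c l)

  threshold : List S → ℕ
  threshold R = suc (entryBound R) + suc (suc (entryBound R))

  opred-dec-pred : ∀ R c k → 3 + entryBound R < lookup c k →
                   pred (↑₀ R) (q , c) → pred (↑₀ R) (q , dec c k)
  opred-dec-pred R c k gap ((q′ , _) , up , inj₁ (refl , g , t∈δ , l , l∈g , 1≤cl)) =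
    (q′ , dec c k) , ↑₀-dec R q′ c k (gap⇒< gap) up ,
    inj₁ (refl , g , t∈δ , l , l∈g , dec-positive c (gap⇒2≤ gap) 1≤cl)
  opred-dec-pred {q} R c k gap ((_ , m) , up , inj₂ ((i , g , j) , t∈δ , b@(refl , _ , refl , _)))
    with k ≟ i
  ... | no k≢i =
    (q , dec m k) , ↑₀-dec R q m k (<-≤-trans (gap⇒< gap) (lookup-move-≥ {c = c} k≢i)) up ,
    based⇒Δ t∈δ (based-dec (gap⇒2≤ gap) (dec-≢-≥ c (k≢i ∘ sym)) b)
  ... | yes refl =
    (q , dec m k) , ↑₀-dec R q m k (<-≤-trans (gap⇒<∸1 gap) (lookup-move-source-pred c k j)) up ,
    based⇒Δ t∈δ (based-dec-source b (gap⇒3≤ gap))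

  -- With M = entryBound R: a chain that leaves at most M+1 processes in q_i has moved more
  -- than M+2 of them to q_j, so the chain one step shorter still ends above R. Chains of one
  -- or two steps leave more.
  opred-dec-skip : ∀ R → i ≢ j → (i , g , j) ∈ₗ δ B → Chain (i , g , j) (q , c) (q′ , y) →
                   ↑₀ R (q′ , y) → (lookup c j ≡ 0 ⊎ lookup y i ≡ 0) →
                   threshold R < lookup c i → lookup y i ≤ suc (entryBound R) →
                   opred (↑₀ R) (q , dec c i)
  opred-dec-skip {c = c} R i≢j _ [ refl , _ , refl , _ ]⁺ _ _ big yi≤ =
    ⊥-elim (<⇒≱ (gap⇒<∸1 (above-threshold _ big)) (subst (_≤ _) (lookup-move-source {c = c} i≢j) yi≤))
  opred-dec-skip {i} {j} {c = c} R i≢j _ ((refl , _ , refl , _) ∷ [ refl , _ , refl , _ ]⁺) _ _ big yi≤ =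
    ⊥-elim (<⇒≱ (gap⇒<∸2 (above-threshold _ big)) (subst (_≤ _) yi≡ci-2 yi≤))
    where
    yi≡ci-2 : lookup (move (move c i j) i j) i ≡ lookup c i ∸ 1 ∸ 1
    yi≡ci-2 =
      trans (lookup-move-source {c = move c i j} i≢j) (cong (_∸ 1) (lookup-move-source {c = c} i≢j))
  opred-dec-skip {i} {j} {c = c} {q′ = q′} {y} R i≢j t∈δ
                 ch@(b@(refl , _ , refl , _) ∷ (_∷_ {y = _ , _} b′@(refl , _ , refl , _) bs))
                 up cond big yi≤ =
    inj₂ ((q′ , dec y j) , ↑₀-dec R q′ y j (conserved-above _ (chain-conserves i≢j ch) yi≤ big) up ,
          _ , t∈δ ,
          based-dec-source b (gap⇒3≤ (above-threshold _ big)) ∷ chain-skip i≢j (move-target-pos c i≢j) b′ bs ,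
          ⊎-map (dec-keeps-zero c) (dec-keeps-zero y) cond)

  opred-dec : ∀ R → DecClosedAbove (threshold R) (λ c → opred (↑₀ R) (q , c))
  opred-dec R c k big (inj₁ p) = inj₁ (opred-dec-pred R c k (above-threshold _ big) p)
  opred-dec R c k big (inj₂ (_ , _ , (i , g , j) , _ , ch , cond)) with i ≟ j
  ... | yes refl = ⊥-elim (chain-self-cond ch cond)
  opred-dec R c k big (inj₂ ((q′ , y) , up , (i , g , j) , t∈δ , ch , cond)) | no i≢j with k ≟ i
  ... | no k≢i =
    inj₂ ((q′ , dec y k) , ↑₀-dec R q′ y k (<-≤-trans (gap⇒< gap) (chain-off-source-≤ ch k k≢i)) up ,
          _ , t∈δ , chain-dec-other k≢i (gap⇒2≤ gap) ch , ⊎-map (dec-keeps-zero c) (dec-keeps-zero y) cond)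
    where
    gap : 3 + entryBound R < lookup c k
    gap = above-threshold _ big
  ... | yes refl with suc (entryBound R) <? lookup y k
  ...   | yes M<yk =
    inj₂ ((q′ , dec y k) , ↑₀-dec R q′ y k M<yk up ,
          _ , t∈δ , chain-dec-source i≢j (≤-trans (s≤s (s≤s z≤n)) M<yk) ch ,
          ⊎-map (dec-keeps-zero c) (dec-keeps-zero y) cond)
  ...   | no M≮yk = opred-dec-skip R i≢j t∈δ ch up cond big (≤-pred (≰⇒> M≮yk))

  -- Deciding opred

  chainPred : (S → Set) → S → Set
  chainPred R (q , c) =
    ∃[ s′ ] (R s′ × ∃[ t ] (t ∈ₗ δ B × Chain t (q , c) s′ ×
                           (lookup c (proj₂ (proj₂ t)) ≡ 0 ⊎ lookup (proj₂ s′) (proj₁ t) ≡ 0)))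

  ≲₀? : ∀ s r → Dec (s ≲₀ r)
  ≲₀? (q , c) (q′ , d) =
    (q ≟ q′) ×-dec fin-all? (λ l → lookup c l ≤? lookup d l) ×-dec
    fin-all? (λ l → zeroIff? (lookup c l) (lookup d l))

  ↑₀? : ∀ R s → Dec (↑₀ R s)
  ↑₀? R s = map′ find (λ (_ , r∈R , r≲s) → lose r∈R r≲s) (any? (λ r → ≲₀? r s) R)

  enabled? : ∀ i g q c → Dec (Enabled i g q c)
  enabled? i g q c =
    (q ∈? proj₁ g) ⊎-dec
    fin-any? (λ l → (l ∈? proj₂ g) ×-dec ¬? (l ≟ i) ×-dec (1 ≤? lookup c l)) ⊎-dec
    ((i ∈? proj₂ g) ×-dec (2 ≤? lookup c i))

  pred? : ∀ R s → Dec (pred (↑₀ R) s)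
  pred? R (q , c) = map′ from to (any? A-step? (δ A) ⊎-dec any? B-step? (δ B))
    where
    A-step : Fin nA × Guard nA nB × Fin nA → Set
    A-step (q₁ , g , q₂) = q₁ ≡ q × (∃[ l ] (l ∈ proj₂ g × 1 ≤ lookup c l)) × ↑₀ R (q₂ , c)
    A-step? : ∀ t → Dec (A-step t)
    A-step? (q₁ , g , q₂) =
      (q₁ ≟ q) ×-dec fin-any? (λ l → (l ∈? proj₂ g) ×-dec (1 ≤? lookup c l)) ×-dec ↑₀? R (q₂ , c)
    B-step : Fin nB × Guard nA nB × Fin nB → Set
    B-step (i , g , j) = (1 ≤ lookup c i × Enabled i g q c) × ↑₀ R (q , move c i j)
    B-step? : ∀ t → Dec (B-step t)
    B-step? (i , g , j) = ((1 ≤? lookup c i) ×-dec enabled? i g q c) ×-dec ↑₀? R (q , move c i j)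
    from : Any A-step (δ A) ⊎ Any B-step (δ B) → pred (↑₀ R) (q , c)
    from (inj₁ steps) with find steps
    ... | (_ , g , q₂) , t∈δ , refl , (l , l∈g , 1≤cl) , up =
      (q₂ , c) , up , inj₁ (refl , g , t∈δ , l , l∈g , 1≤cl)
    from (inj₂ steps) with find steps
    ... | t , t∈δ , (1≤ci , en) , up = _ , up , inj₂ (t , t∈δ , refl , 1≤ci , refl , en)
    to : pred (↑₀ R) (q , c) → Any A-step (δ A) ⊎ Any B-step (δ B)
    to (_ , up , inj₁ (refl , g , t∈δ , l , l∈g , 1≤cl)) = inj₁ (lose t∈δ (refl , (l , l∈g , 1≤cl) , up))
    to (_ , up , inj₂ (_ , t∈δ , refl , 1≤ci , refl , en)) = inj₂ (lose t∈δ ((1≤ci , en) , up))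

  chain? : ∀ {P : S → Set} → (∀ s → Dec (P s)) → i ≢ j → ∀ q c →
           Dec (∃[ s′ ] (P s′ × Chain (i , g , j) (q , c) s′))
  chain? {i} {j} {g} {P} P? i≢j q c = search (lookup c i) c refl
    where
    ChainFrom : Vec ℕ nB → Set
    ChainFrom c = ∃[ s′ ] (P s′ × Chain (i , g , j) (q , c) s′)
    search-from : ∀ c → 1 ≤ lookup c i → Dec (Enabled i g q c) → Dec (P (q , move c i j)) →
                  Dec (ChainFrom (move c i j)) → Dec (ChainFrom c)
    search-from c _ (no ¬en) _ _ = no λ where
      (_ , _ , [ _ , _ , _ , en ]⁺) → ¬en en
      (_ , _ , ((_ , _ , _ , en) ∷ _)) → ¬en en
    search-from c 1≤ci (yes en) (yes p) _ = yes (_ , p , [ based-step 1≤ci en ]⁺)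
    search-from c 1≤ci (yes en) (no _) (yes (s′ , p , ch)) = yes (s′ , p , based-step 1≤ci en ∷ ch)
    search-from c _ (yes _) (no ¬p) (no ¬ch) = no λ where
      (_ , p , [ refl , _ , refl , _ ]⁺) → ¬p p
      (s′ , p , ((refl , _ , refl , _) ∷ ch)) → ¬ch (s′ , p , ch)
    search : ∀ n c → lookup c i ≡ n → Dec (ChainFrom c)
    search zero c ci≡0 = no λ (_ , _ , ch) → n>0⇒n≢0 (chain-source-pos ch) ci≡0
    search (suc n) c ci≡1+n =
      search-from c (subst (1 ≤_) (sym ci≡1+n) (s≤s z≤n)) (enabled? i g q c) (P? (q , move c i j))
                  (search n (move c i j) (trans (lookup-move-source {c = c} i≢j) (cong (_∸ 1) ci≡1+n)))

  opred? : ∀ R s → Dec (opred (↑₀ R) s)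
  opred? R (q , c) = pred? R (q , c) ⊎-dec map′ from to (any? chain-to? (δ B))
    where
    ChainTo : Fin nB × Guard nA nB × Fin nB → Set
    ChainTo t@(i , _ , j) =
      ∃[ s′ ] ((↑₀ R s′ × (lookup c j ≡ 0 ⊎ lookup (proj₂ s′) i ≡ 0)) × Chain t (q , c) s′)
    chain-to? : ∀ t → Dec (ChainTo t)
    chain-to? (i , g , j) with i ≟ j
    ... | yes refl = no λ ((_ , _) , (_ , cond) , ch) → chain-self-cond ch cond
    ... | no i≢j =
      chain? (λ s′ → ↑₀? R s′ ×-dec ((lookup c j ≟ℕ 0) ⊎-dec (lookup (proj₂ s′) i ≟ℕ 0))) i≢j q c
    from : Any ChainTo (δ B) → chainPred (↑₀ R) (q , c)
    from chains with find chains
    ... | t , t∈δ , s′ , (up , cond) , ch = s′ , up , t , t∈δ , ch , cond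
    to : chainPred (↑₀ R) (q , c) → Any ChainTo (δ B)
    to (s′ , up , t , t∈δ , ch , cond) = lose t∈δ (s′ , (up , cond) , ch)

  statesUpTo : ℕ → List S
  statesUpTo N = cartesianProduct (allFin nA) (vectorsUpTo N nB)

  opredBasis : List S → List S
  opredBasis R = filter (opred? R) (statesUpTo (threshold R))

  opredBasis-isBasis : ∀ R → IsBasis (opredBasis R) (opred (↑₀ R))
  opredBasis-isBasis R s@(q , c) = mk⇔ sound complete
    where
    N : ℕ
    N = threshold R
    sound : ↑₀ (opredBasis R) s → opred (↑₀ R) s
    sound (b , b∈basis , b≲s) =
      opred-upward R b s (proj₂ (∈-filter⁻ (opred? R) {xs = statesUpTo N} b∈basis)) b≲s
    complete : opred (↑₀ R) s → ↑₀ (opredBasis R) s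
    complete op =
      (q , clamp N c) ,
      ∈-filter⁺ (opred? R)
                (∈-cartesianProduct⁺ (∈-allFin q) (∈-vectorsUpTo N (clamp N c) (clamp-≤-bound N c)))
                (dec-closed⇒clamp (opred-dec R) op) ,
      refl , clamp-≤ N c , clamp-zeroIff (s≤s z≤n) c

lemma5 : ∀ {nA nB} (A : Template nA nB nA) (B : Template nA nB nB) →
    NoSelfGuard B → CounterSystem.WSTSWithEffectiveOpredBasis A B
lemma5 A B _ = ≲₀-wqo A B , compatible A B , opredBasis A B , opredBasis-isBasis A B
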